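{- Let $\mathbf{tr}$ be the Tribonacci word, the fixed point of the morphism $0\mapsto01$, $1\mapsto02$, $2\mapsto0$ starting with $0$. The additive complexity $\rho^{\mathrm{add}}_{\mathbf{tr}}(n)$ takes only values in $\{3,4,5\}$ for $n\ge1$. Furthermore, each of the three values $3,4,5$ is taken for infinitely many $n$, and $\rho^{\mathrm{add}}_{\mathbf{tr}}$ is computed by a $76$-state Tribonacci DFAO.
   Context: Letters $0,1,2$ are regarded as integers. Words $u,v$ are additively equivalent if $|u|=|v|$ and $|u|_1+2|u|_2=|v|_1+2|v|_2$ ($|w|_a$ counts occurrences of $a$); $\rho^{\mathrm{add}}_{\mathbf{tr}}(n)$ is the number of additive equivalence classes of length-$n$ factors of $\mathbf{tr}$. Tribonacci numbers: $T(0)=1,T(1)=2,T(2)=4$, $T(n)=T(n-1)+T(n-2)+T(n-3)$ for $n\ge3$. The Tribonacci representation of $n$ is its greedy representation $n=\sum_{i=0}^t c(i)T(i)$ written most significant digit first (empty for $n=0$). A Tribonacci DFAO is a deterministic finite automaton with output which, on input the Tribonacci representation of $n$, outputs the $n$th term. -}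

module Defs where

open import Data.Nat using (ℕ; zero; suc; _+_; _*_; _≤_; _≤ᵇ_)
open import Data.Fin using (Fin; zero; suc)
open import Data.List using (List; []; _∷_; _++_; concatMap; length; map; foldl; dropWhileᵇ; filter)
open import Data.List.Membership.Propositional using (_∈_)
open import Data.List.Relation.Unary.Any using (Any)
open import Data.List.Relation.Unary.AllPairs using (AllPairs)
open import Data.Bool using (if_then_else_)
open import Data.Product using (Σ; ∃; _×_)
open import Relation.Binary.PropositionalEquality using (_≡_)
open import Relation.Nullary using (¬_)
open import Data.Fin using (_≟_)
open import Relation.Nullary.Decidable using (⌊_⌋)

Letter : Set
Letter = Fin 3

Word : Set
Word = List Letter

σ : Letter → Word
σ zero = zero ∷ suc zero ∷ []
σ (suc zero) = zero ∷ suc (suc zero) ∷ []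
σ (suc (suc zero)) = zero ∷ []

σ* : Word → Word
σ* = concatMap σ

σ^ : ℕ → Word
σ^ zero = zero ∷ []
σ^ (suc k) = σ* (σ^ k)

nth : Word → ℕ → Letter
nth [] _ = zero
nth (a ∷ w) zero = a
nth (a ∷ w) (suc n) = nth w n

-- The Tribonacci word tr = lim σ^k(0) (fixed point of σ starting with 0);
-- |σ^(n+1)(0)| ≥ n+1, so its n-th letter is the n-th letter of tr.
tr : ℕ → Letter
tr n = nth (σ^ (suc n)) n

factor : ℕ → ℕ → Word
factor i zero = []
factor i (suc n) = tr i ∷ factor (suc i) n

occ : Letter → Word → ℕ
occ a w = length (filter (λ b → b ≟ a) w)

AddEquiv : Word → Word → Set
AddEquiv u v = (length u ≡ length v) ×
  (occ (suc zero) u + 2 * occ (suc (suc zero)) u ≡ occ (suc zero) v + 2 * occ (suc (suc zero)) v)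

IsFactor : ℕ → Word → Set
IsFactor n u = ∃ λ i → factor i n ≡ u

AddComplexity : ℕ → ℕ → Set
AddComplexity n k = Σ (List Word) λ reps →
  (length reps ≡ k) ×
  ((u : Word) → u ∈ reps → IsFactor n u) ×
  AllPairs (λ u v → ¬ AddEquiv u v) reps ×
  ((i : ℕ) → Any (AddEquiv (factor i n)) reps)

T : ℕ → ℕ
T zero = 1
T (suc zero) = 2
T (suc (suc zero)) = 4
T (suc (suc (suc n))) = T (suc (suc n)) + T (suc n) + T n

-- Greedy digits at positions i, i-1, …, 0 of remainder r (most significant first).
-- (Since T(i+1) < 2 T(i), a greedy digit is 1 iff T(i) ≤ r.)
greedy : ℕ → ℕ → List (Fin 2)
greedy zero r = if T zero ≤ᵇ r then suc zero ∷ [] else zero ∷ []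
greedy (suc i) r = if T (suc i) ≤ᵇ r
  then suc zero ∷ greedy i (r Data.Nat.∸ T (suc i))
  else zero ∷ greedy i r

isZero : Fin 2 → Data.Bool.Bool
isZero zero = Data.Bool.true
isZero (suc _) = Data.Bool.false

-- Tribonacci representation of n (most significant digit first, empty for 0):
-- greedy from position n (note n < T(n)), then strip leading zeros.
trib : ℕ → List (Fin 2)
trib n = dropWhileᵇ isZero (greedy n n)

record DFAO (Q : Set) (O : Set) : Set where
  field
    q₀  : Q
    δ   : Q → Fin 2 → Q
    out : Q → O

run : ∀ {Q O} → DFAO Q O → List (Fin 2) → Q
run M w = foldl (DFAO.δ M) (DFAO.q₀ M) w

eval : ∀ {Q O} → DFAO Q O → List (Fin 2) → O
eval M w = DFAO.out M (run M w)

{-# OPTIONS --safe #-}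

-- Call b(n) + c, with b(n) = |σ*(tr[0..n))| and c an index into the block σ(tr n), a child of n; the
-- representation of the child is that of n with c appended. To a length n and a position i attach a
-- window: the letter counts of the factor of length n at i, minus those of the prefix of length n,
-- and a few letters around both ends. The window of a child of n at a child of i is determined by
-- the window of n at i, so the set of all windows of a child of n is determined by the set of all
-- windows of n. Only 422 pairs (letter, set of windows) are reachable from n = 1, and the set of
-- windows determines the additive complexity: it is the number of distinct weights of its elements.
-- An exhaustive search checks that these pairs map onto the 76 states of the automaton, and each of
-- the values 3, 4, 5 is the output at a state lying on a cycle.

module Submission where

open import Defs
open import Data.Bool using (true; false; if_then_else_)
open import Data.Bool.Properties using (T-≡)
open import Data.Empty using (⊥-elim)
open import Data.Fin as Fin using (Fin; zero; suc; toℕ)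
import Data.Fin.Properties as Fin
open import Data.Integer as ℤ using (ℤ; +_; ∣_∣)
import Data.Integer.Properties as ℤ
open import Data.Integer.Tactic.RingSolver using () renaming (solve-∀ to ℤ-solve-∀)
open import Data.List
  using (List; []; _∷_; _++_; [_]; _∷ʳ_; take; drop; map; length; replicate; dropWhileᵇ; foldl; filter;
    foldr; concatMap; deduplicate)
open import Data.List.Membership.Propositional using (_∈_; find; lose)
import Data.List.Membership.DecPropositional as DecMembership
open import Data.List.Membership.Propositional.Properties
  using (∈-map⁺; ∈-map⁻; ∈-concatMap⁺; ∈-concatMap⁻; ∈-deduplicate⁺; ∈-deduplicate⁻)
import Data.List.Properties as List
open import Data.List.Properties
  using (length-++; filter-++; concatMap-++; ++-identityʳ; ∷-injective; length-replicate)
import Data.List.Relation.Binary.Sublist.Propositional as Sublist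
open Sublist using (_⊆_)
open import Data.List.Relation.Unary.All as All using (All; []; _∷_; all?)
import Data.List.Relation.Unary.AllPairs as AllPairs
open AllPairs using ([]; _∷_)
import Data.List.Relation.Unary.AllPairs.Properties as AllPairs
open import Data.List.Relation.Unary.Any as Any using (Any; here; there)
open import Data.List.Relation.Unary.Unique.DecPropositional.Properties ℤ._≟_ using (deduplicate-!)
open import Data.List.Relation.Unary.Unique.Propositional using (Unique)
open import Data.Nat as ℕ
  using (ℕ; zero; suc; pred; _+_; _*_; _∸_; _/_; _%_; _≤_; _≤?_; _<_; _≤ᵇ_; _<ᵇ_; _≡ᵇ_; z≤n; s≤s; >-nonZero)
open import Data.List.Relation.Binary.Sublist.DecPropositional ℕ._≟_ using (_⊆?_)
open import Data.Nat.DivMod using (_mod_)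
open import Data.Nat.Induction using (<-rec)
open import Data.Nat.Properties
  using (+-assoc; +-cancelʳ-≡; +-comm; +-identityʳ; +-mono-≤; +-monoʳ-<; +-suc; *-identityʳ; *-identityˡ;
    *-zeroʳ; suc-injective; suc-pred; n<1+n; m≤m+n; m≤n⇒m≤1+n; m+[n∸m]≡n; m∸n+n≡m; m+n∸m≡n;
    m+n≤o⇒m≤o∸n; ≤-refl; ≤-reflexive; ≤-trans; <-trans; <-≤-trans; ≤-<-trans; <⇒≤; <⇒≱; ≤⇒≤ᵇ; ≤ᵇ⇒≤; ≡ᵇ⇒≡;
    module ≤-Reasoning)
open import Data.Nat.Tactic.RingSolver using (solve-∀)
open import Data.Product using (Σ; ∃; ∃₂; _×_; _,_; proj₁; proj₂)
import Data.Product.Properties as ×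
open import Data.Sum as Sum using (_⊎_; inj₁; inj₂)
open import Data.Unit using (tt)
open import Data.Vec as Vec using (Vec; []; _∷_; lookup; updateAt)
open import Function.Bundles using (Equivalence)
open import Relation.Binary using (DecidableEquality)
open import Relation.Binary.PropositionalEquality hiding ([_])
open import Relation.Nullary.Decidable using (Dec; does; True; toWitness; _×-dec_; _⊎-dec_)

-- Letters, digits and children

pattern 𝟎 = zero
pattern 𝟏 = suc zero
pattern 𝟐 = suc (suc zero)

Digit : Set
Digit = Fin 2

-- The edges of the numeration graph: paths from `𝟎` spell the digit words without 111, because `𝟐`
-- has a single child.
children : Letter → List (Digit × Letter)
children 𝟎 = (𝟎 , 𝟎) ∷ (𝟏 , 𝟏) ∷ []
children 𝟏 = (𝟎 , 𝟎) ∷ (𝟏 , 𝟐) ∷ []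
children 𝟐 = (𝟎 , 𝟎) ∷ []

0-child : ∀ a → (𝟎 , 𝟎) ∈ children a
0-child 𝟎 = here refl
0-child 𝟏 = here refl
0-child 𝟐 = here refl

-- Factors of `tr`

factor-length : ∀ s n → length (factor s n) ≡ n
factor-length s zero = refl
factor-length s (suc n) = cong suc (factor-length (suc s) n)

factor-++ : ∀ s m n → factor s (m + n) ≡ factor s m ++ factor (s + m) n
factor-++ s zero n = cong (λ t → factor t n) (sym (+-identityʳ s))
factor-++ s (suc m) n = cong (tr s ∷_) (trans (factor-++ (suc s) m n)
  (cong (λ t → factor (suc s) m ++ factor t n) (sym (+-suc s m))))

factor-split : ∀ s u {r n} → factor s n ≡ u ++ r →
  u ≡ factor s (length u) × r ≡ factor (s + length u) (length r)
factor-split s [] {n = n} refl = refl ,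
  cong₂ factor (sym (+-identityʳ s)) (sym (factor-length s n))
factor-split s (a ∷ u) {r} {suc n} eq with ∷-injective eq
... | refl , eq′ with factor-split (suc s) u {r} {n} eq′
... | p , q = cong (tr s ∷_) p , trans q (cong (λ t → factor t (length r)) (sym (+-suc s (length u))))

take-factor : ∀ s k {n} → k ≤ n → take k (factor s n) ≡ factor s k
take-factor s zero _ = refl
take-factor s (suc k) (s≤s k≤n) = cong (tr s ∷_) (take-factor (suc s) k k≤n)

drop-factor : ∀ s k n → drop k (factor s n) ≡ factor (s + k) (n ∸ k)
drop-factor s zero n = cong (λ t → factor t n) (sym (+-identityʳ s))
drop-factor s (suc k) zero = refl
drop-factor s (suc k) (suc n) = trans (drop-factor (suc s) k n) (cong (λ t → factor t (n ∸ k)) (sym (+-suc s k)))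

occ-++ : ∀ a u v → occ a (u ++ v) ≡ occ a u + occ a v
occ-++ a u v = trans (cong length (filter-++ (Fin._≟ a) u v)) (length-++ (filter (Fin._≟ a) u))

-- The image of `tr` under the morphism

σ*-++ : ∀ u v → σ* (u ++ v) ≡ σ* u ++ σ* v
σ*-++ = concatMap-++ σ

σ*-length : ∀ w → length w ≤ length (σ* w)
σ*-length [] = z≤n
σ*-length (𝟎 ∷ w) = s≤s (m≤n⇒m≤1+n (σ*-length w))
σ*-length (𝟏 ∷ w) = s≤s (m≤n⇒m≤1+n (σ*-length w))
σ*-length (𝟐 ∷ w) = s≤s (σ*-length w)

-- This is σ^k(1): since σ(0) = 01, it is what σ^(k+1)(0) adds to σ^k(0).
growth : ℕ → Word
growth zero = 𝟏 ∷ []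
growth (suc k) = σ* (growth k)

σ^-suc : ∀ k → σ^ (suc k) ≡ σ^ k ++ growth k
σ^-suc zero = refl
σ^-suc (suc k) = trans (cong σ* (σ^-suc k)) (σ*-++ (σ^ k) (growth k))

growth-nonempty : ∀ k → 1 ≤ length (growth k)
growth-nonempty zero = s≤s z≤n
growth-nonempty (suc k) = ≤-trans (growth-nonempty k) (σ*-length (growth k))

σ^-length : ∀ k → k < length (σ^ k)
σ^-length zero = s≤s z≤n
σ^-length (suc k) = begin
  2 + k                              ≡⟨ +-comm 1 (suc k) ⟩
  suc k + 1                          ≤⟨ +-mono-≤ (σ^-length k) (growth-nonempty k) ⟩
  length (σ^ k) + length (growth k)  ≡⟨ length-++ (σ^ k) ⟨
  length (σ^ k ++ growth k)          ≡⟨ cong length (σ^-suc k) ⟨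
  length (σ^ (suc k))                ∎
  where open ≤-Reasoning

nth-++ : ∀ u v {n} → n < length u → nth (u ++ v) n ≡ nth u n
nth-++ (a ∷ u) v {zero} _ = refl
nth-++ (a ∷ u) v {suc n} (s≤s n<u) = nth-++ u v n<u

nth-σ^-+ : ∀ j k {n} → n < length (σ^ k) → n < length (σ^ (j + k)) × nth (σ^ (j + k)) n ≡ nth (σ^ k) n
nth-σ^-+ zero k n< = n< , refl
nth-σ^-+ (suc j) k {n} n< with nth-σ^-+ j k n<
... | n<′ , eq rewrite σ^-suc (j + k) =
  <-≤-trans n<′ (≤-trans (m≤m+n _ _) (≤-reflexive (sym (length-++ (σ^ (j + k)))))) ,
  trans (nth-++ (σ^ (j + k)) (growth (j + k)) n<′) eq

-- Both `σ^ k` and `σ^ (suc n)` are prefixes of `σ^ (suc n + k)`.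
nth-σ^ : ∀ k {n} → n < length (σ^ k) → nth (σ^ k) n ≡ tr n
nth-σ^ k {n} n< = begin
  nth (σ^ k) n            ≡⟨ proj₂ (nth-σ^-+ (suc n) k n<) ⟨
  nth (σ^ (suc n + k)) n  ≡⟨ cong (λ j → nth (σ^ j) n) (+-comm (suc n) k) ⟩
  nth (σ^ (k + suc n)) n  ≡⟨ proj₂ (nth-σ^-+ k (suc n) (<-trans (n<1+n n) (σ^-length (suc n)))) ⟩
  tr n                    ∎
  where open ≡-Reasoning

nth⇒factor : ∀ s w → (∀ {n} → n < length w → nth w n ≡ tr (s + n)) → w ≡ factor s (length w)
nth⇒factor s [] h = refl
nth⇒factor s (a ∷ w) h = cong₂ _∷_ (trans (h (s≤s z≤n)) (cong tr (+-identityʳ s)))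
  (nth⇒factor (suc s) w λ {n} n< → trans (h (s≤s n<)) (cong tr (+-suc s n)))

σ^-factor : ∀ k → σ^ k ≡ factor 0 (length (σ^ k))
σ^-factor k = nth⇒factor 0 (σ^ k) (nth-σ^ k)

blockStart : ℕ → ℕ
blockStart n = length (σ* (factor 0 n))

-- The prefix `σ^ (s + n)` of `tr` contains the factor, and its image `σ^ (suc (s + n))` is again a
-- prefix of `tr`. Cutting off the images of `factor 0 s` and of the last `r` letters locates the
-- image of the factor.
σ*-factor : ∀ s n → σ* (factor s n) ≡ factor (blockStart s) (length (σ* (factor s n)))
σ*-factor s n = proj₁ (factor-split (blockStart s) (σ* (factor s n)) (sym (proj₂ (factor-split 0 (σ* (factor 0 s)) image))))
  where
  open ≡-Reasoning
  r = length (σ^ (s + n)) ∸ (s + n)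
  image : factor 0 (length (σ^ (suc (s + n)))) ≡ σ* (factor 0 s) ++ (σ* (factor s n) ++ σ* (factor (s + n) r))
  image = begin
    factor 0 (length (σ^ (suc (s + n))))  ≡⟨ σ^-factor (suc (s + n)) ⟨
    σ* (σ^ (s + n))                       ≡⟨ cong σ* (σ^-factor (s + n)) ⟩
    σ* (factor 0 (length (σ^ (s + n))))
      ≡⟨ cong (λ l → σ* (factor 0 l)) (trans (sym (m+[n∸m]≡n (<⇒≤ (σ^-length (s + n))))) (+-assoc s n r)) ⟩
    σ* (factor 0 (s + (n + r)))           ≡⟨ cong σ* (factor-++ 0 s (n + r)) ⟩
    σ* (factor 0 s ++ factor s (n + r))   ≡⟨ σ*-++ (factor 0 s) _ ⟩
    σ* (factor 0 s) ++ σ* (factor s (n + r))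
      ≡⟨ cong (λ w → σ* (factor 0 s) ++ w) (trans (cong σ* (factor-++ s n r)) (σ*-++ (factor s n) _)) ⟩
    σ* (factor 0 s) ++ (σ* (factor s n) ++ σ* (factor (s + n) r)) ∎

blockStart-suc : ∀ n → blockStart (suc n) ≡ blockStart n + length (σ (tr n))
blockStart-suc n = begin
  length (σ* (factor 0 (suc n)))                  ≡⟨ cong (λ l → length (σ* (factor 0 l))) (+-comm 1 n) ⟩
  length (σ* (factor 0 (n + 1)))                  ≡⟨ cong (λ w → length (σ* w)) (factor-++ 0 n 1) ⟩
  length (σ* (factor 0 n ++ [ tr n ]))            ≡⟨ cong length (σ*-++ (factor 0 n) [ tr n ]) ⟩
  length (σ* (factor 0 n) ++ σ* [ tr n ])         ≡⟨ length-++ (σ* (factor 0 n)) ⟩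
  blockStart n + length (σ* [ tr n ])             ≡⟨ cong (λ w → blockStart n + length w) (++-identityʳ (σ (tr n))) ⟩
  blockStart n + length (σ (tr n))                ∎
  where open ≡-Reasoning

tr-child : ∀ n {d a} → (d , a) ∈ children (tr n) → tr (blockStart n + toℕ d) ≡ a
tr-child n {d} {a} p = go (tr n) (σ*-factor n 1) p
  where
  s = blockStart n
  +0 : tr (s + 0) ≡ tr s
  +0 = cong tr (+-identityʳ s)
  +1 : tr (s + 1) ≡ tr (suc s)
  +1 = cong tr (+-comm s 1)
  go : ∀ x → σ* (x ∷ []) ≡ factor s (length (σ* (x ∷ []))) → (d , a) ∈ children x → tr (s + toℕ d) ≡ a
  go 𝟎 eq (here refl) = trans +0 (sym (proj₁ (∷-injective eq)))
  go 𝟎 eq (there (here refl)) = trans +1 (sym (proj₁ (∷-injective (proj₂ (∷-injective eq)))))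
  go 𝟏 eq (here refl) = trans +0 (sym (proj₁ (∷-injective eq)))
  go 𝟏 eq (there (here refl)) = trans +1 (sym (proj₁ (∷-injective (proj₂ (∷-injective eq)))))
  go 𝟐 eq (here refl) = trans +0 (sym (proj₁ (∷-injective eq)))

tr-blockStart : ∀ n → tr (blockStart n) ≡ 𝟎
tr-blockStart n = trans (cong tr (sym (+-identityʳ (blockStart n)))) (tr-child n (0-child (tr n)))

σ-nonempty : ∀ a → 1 ≤ length (σ a)
σ-nonempty 𝟎 = s≤s z≤n
σ-nonempty 𝟏 = s≤s z≤n
σ-nonempty 𝟐 = s≤s z≤n

-- The first block 01 has length 2 and no block is empty. Inductions along parents rest on this
-- strict inequality.
n<blockStart : ∀ n → suc n < blockStart (suc n)
n<blockStart zero = s≤s (s≤s z≤n)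
n<blockStart (suc n) = begin
  1 + suc (suc n)                                     ≡⟨ +-comm 1 (suc (suc n)) ⟩
  suc (suc n) + 1                                     ≤⟨ +-mono-≤ (n<blockStart n) (σ-nonempty (tr (suc n))) ⟩
  blockStart (suc n) + length (σ (tr (suc n)))        ≡⟨ blockStart-suc (suc n) ⟨
  blockStart (suc (suc n))                            ∎
  where open ≤-Reasoning

-- Parents of positions

record Parent (p : ℕ) : Set where
  constructor mkParent
  field
    n : ℕ
    d : Digit
    is-child : (d , tr p) ∈ children (tr n)
    position : p ≡ blockStart n + toℕ d

childParent : ∀ {p} n {d a} → (d , a) ∈ children (tr n) → p ≡ blockStart n + toℕ d → Parent p
childParent n {d} p refl = mkParent n d (subst (λ a → (d , a) ∈ children (tr n)) (sym (tr-child n p)) p) refl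

-- Induction on the position: after a child comes either its sibling in the same block or the first
-- letter of the next block.
parent : ∀ p → Parent p
parent zero = childParent 0 (here refl) refl
parent (suc p) with parent p
... | mkParent n d h eq = next (tr n) refl d (tr p) h (cong suc eq)
  where
  end : ∀ x → tr n ≡ x → blockStart (suc n) ≡ blockStart n + length (σ x)
  end _ refl = blockStart-suc n
  sibling : ∀ x → tr n ≡ x → ∀ {a} → (𝟏 , a) ∈ children x → suc p ≡ suc (blockStart n + 0) → Parent (suc p)
  sibling _ refl h eq = childParent n h (trans eq (sym (+-suc _ 0)))
  following : ∀ k → blockStart (suc n) ≡ blockStart n + suc k → suc p ≡ suc (blockStart n + k) → Parent (suc p)
  following k e eq = childParent (suc n) (0-child _)
    (trans eq (trans (sym (+-suc _ k)) (trans (sym e) (sym (+-identityʳ _)))))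
  next : ∀ x → tr n ≡ x → ∀ d a → (d , a) ∈ children x → suc p ≡ suc (blockStart n + toℕ d) → Parent (suc p)
  next 𝟎 e 𝟎 _ _ eq = sibling 𝟎 e (there (here refl)) eq
  next 𝟎 e 𝟏 _ _ eq = following 1 (end 𝟎 e) eq
  next 𝟏 e 𝟎 _ _ eq = sibling 𝟏 e (there (here refl)) eq
  next 𝟏 e 𝟏 _ _ eq = following 1 (end 𝟏 e) eq
  next 𝟐 e 𝟎 _ _ eq = following 0 (end 𝟐 e) eq
  next 𝟐 e 𝟏 _ (there ()) eq

n<child : ∀ n (d : Digit) → 1 ≤ n → n < blockStart n + toℕ d
n<child (suc n) d _ = <-≤-trans (n<blockStart n) (m≤m+n _ _)

-- Letter counts of prefixes and of their images

count : Letter → ℕ → ℕ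
count a n = occ a (factor 0 n)

count-+ : ∀ a s n → count a (s + n) ≡ count a s + occ a (factor s n)
count-+ a s n = trans (cong (occ a) (factor-++ 0 s n)) (occ-++ a (factor 0 s) _)

length-occ : ∀ w → length w ≡ occ 𝟎 w + occ 𝟏 w + occ 𝟐 w
length-occ [] = refl
length-occ (𝟎 ∷ w) = cong suc (length-occ w)
length-occ (𝟏 ∷ w) = trans (cong suc (length-occ w)) (cong (_+ occ 𝟐 w) (sym (+-suc (occ 𝟎 w) _)))
length-occ (𝟐 ∷ w) = trans (cong suc (length-occ w)) (sym (+-suc (occ 𝟎 w + occ 𝟏 w) _))

occ-σ*-0 : ∀ w → occ 𝟎 (σ* w) ≡ length w
occ-σ*-0 [] = refl
occ-σ*-0 (𝟎 ∷ w) = cong suc (occ-σ*-0 w)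
occ-σ*-0 (𝟏 ∷ w) = cong suc (occ-σ*-0 w)
occ-σ*-0 (𝟐 ∷ w) = cong suc (occ-σ*-0 w)

occ-σ*-1 : ∀ w → occ 𝟏 (σ* w) ≡ occ 𝟎 w
occ-σ*-1 [] = refl
occ-σ*-1 (𝟎 ∷ w) = cong suc (occ-σ*-1 w)
occ-σ*-1 (𝟏 ∷ w) = occ-σ*-1 w
occ-σ*-1 (𝟐 ∷ w) = occ-σ*-1 w

occ-σ*-2 : ∀ w → occ 𝟐 (σ* w) ≡ occ 𝟏 w
occ-σ*-2 [] = refl
occ-σ*-2 (𝟎 ∷ w) = occ-σ*-2 w
occ-σ*-2 (𝟏 ∷ w) = cong suc (occ-σ*-2 w)
occ-σ*-2 (𝟐 ∷ w) = occ-σ*-2 w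

count-sum : ∀ n → n ≡ count 𝟎 n + count 𝟏 n + count 𝟐 n
count-sum n = trans (sym (factor-length 0 n)) (length-occ (factor 0 n))

count-blockStart : ∀ a n → count a (blockStart n) ≡ occ a (σ* (factor 0 n))
count-blockStart a n = cong (occ a) (sym (σ*-factor 0 n))

occ-child : ∀ a n (d : Digit) → occ a (factor (blockStart n) (toℕ d)) ≡ toℕ d * occ a [ 𝟎 ]
occ-child a n 𝟎 = refl
occ-child a n 𝟏 = trans (cong (λ x → occ a [ x ]) (tr-blockStart n)) (sym (+-identityʳ _))

count-child : ∀ a n (d : Digit) → count a (blockStart n + toℕ d) ≡ occ a (σ* (factor 0 n)) + toℕ d * occ a [ 𝟎 ]
count-child a n d = trans (count-+ a (blockStart n) (toℕ d)) (cong₂ _+_ (count-blockStart a n) (occ-child a n d))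

count-child-0 : ∀ n (d : Digit) → count 𝟎 (blockStart n + toℕ d) ≡ n + toℕ d
count-child-0 n d = trans (count-child 𝟎 n d)
  (cong₂ _+_ (trans (occ-σ*-0 (factor 0 n)) (factor-length 0 n)) (*-identityʳ (toℕ d)))

count-child-1 : ∀ n (d : Digit) → count 𝟏 (blockStart n + toℕ d) ≡ count 𝟎 n
count-child-1 n d = trans (count-child 𝟏 n d)
  (trans (cong₂ _+_ (occ-σ*-1 (factor 0 n)) (*-zeroʳ (toℕ d))) (+-identityʳ _))

count-child-2 : ∀ n (d : Digit) → count 𝟐 (blockStart n + toℕ d) ≡ count 𝟏 n
count-child-2 n d = trans (count-child 𝟐 n d)
  (trans (cong₂ _+_ (occ-σ*-2 (factor 0 n)) (*-zeroʳ (toℕ d))) (+-identityʳ _))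

-- The image of a letter has length 2, except that of `𝟐`, which has length 1. The count stays on
-- the left to avoid truncated subtraction.
blockStart-count : ∀ n → blockStart n + count 𝟐 n ≡ n + n
blockStart-count n = begin
  blockStart n + count 𝟐 n
    ≡⟨ cong (_+ count 𝟐 n) (trans (length-occ (σ* w)) (cong₂ _+_ (cong₂ _+_ (occ-σ*-0 w) (occ-σ*-1 w)) (occ-σ*-2 w))) ⟩
  length w + count 𝟎 n + count 𝟏 n + count 𝟐 n
    ≡⟨ cong (λ l → l + count 𝟎 n + count 𝟏 n + count 𝟐 n) (factor-length 0 n) ⟩
  n + count 𝟎 n + count 𝟏 n + count 𝟐 n
    ≡⟨ trans (cong (_+ count 𝟐 n) (+-assoc n _ _)) (+-assoc n _ _) ⟩
  n + (count 𝟎 n + count 𝟏 n + count 𝟐 n)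
    ≡⟨ cong (λ y → n + y) (count-sum n) ⟨
  n + n ∎
  where
  open ≡-Reasoning
  w = factor 0 n

-- Tribonacci representations as paths of children

data Path : Letter → List Digit → Letter → Set where
  []  : ∀ {a} → Path a [] a
  _∷_ : ∀ {a b e d w} → (d , b) ∈ children a → Path b w e → Path a (d ∷ w) e

_∷ʳᵖ_ : ∀ {a b e w d} → Path a w b → (d , e) ∈ children b → Path a (w ∷ʳ d) e
[] ∷ʳᵖ s = s ∷ []
(r ∷ p) ∷ʳᵖ s = r ∷ (p ∷ʳᵖ s)

-- |σᵏ(a)|
size : Letter → ℕ → ℕ
size a zero = 1
size 𝟎 (suc k) = size 𝟎 k + size 𝟏 k
size 𝟏 (suc k) = size 𝟎 k + size 𝟐 k
size 𝟐 (suc k) = size 𝟎 k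

T-size : ∀ k → T k ≡ size 𝟎 k
T-size zero = refl
T-size (suc zero) = refl
T-size (suc (suc zero)) = refl
T-size (suc (suc (suc k))) = trans
  (cong₂ _+_ (cong₂ _+_ (T-size (suc (suc k))) (T-size (suc k))) (T-size k))
  (+-assoc (size 𝟎 (suc (suc k))) (size 𝟎 (suc k)) (size 𝟎 k))

size-pos : ∀ a k → 1 ≤ size a k
size-pos a zero = s≤s z≤n
size-pos 𝟎 (suc k) = ≤-trans (size-pos 𝟎 k) (m≤m+n _ _)
size-pos 𝟏 (suc k) = ≤-trans (size-pos 𝟎 k) (m≤m+n _ _)
size-pos 𝟐 (suc k) = size-pos 𝟎 k

n<T : ∀ n → n < T n
n<T n = subst (n <_) (sym (T-size n)) (n<size n)
  where
  n<size : ∀ n → n < size 𝟎 n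
  n<size zero = s≤s z≤n
  n<size (suc n) = ≤-trans (≤-reflexive (+-comm 1 (suc n))) (+-mono-≤ (n<size n) (size-pos 𝟏 n))

value : List Digit → ℕ
value [] = 0
value (d ∷ w) = toℕ d * T (length w) + value w

-- In σ^(k+1)(a) = σ^k(0)σ^k(b), where the second block is absent for a = 2, a digit 0 selects the
-- first block and a digit 1 skips it, adding its length `T k`.
value-< : ∀ {a w e} → Path a w e → value w < size a (length w)
value-< [] = s≤s z≤n
value-< {𝟎} {_ ∷ w} (here refl ∷ p) = <-≤-trans (value-< p) (m≤m+n _ _)
value-< {𝟏} {_ ∷ w} (here refl ∷ p) = <-≤-trans (value-< p) (m≤m+n _ _)
value-< {𝟐} {_ ∷ w} (here refl ∷ p) = value-< p
value-< {𝟎} {_ ∷ w} (there (here refl) ∷ p)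
  rewrite T-size (length w) | +-identityʳ (size 𝟎 (length w)) = +-monoʳ-< (size 𝟎 (length w)) (value-< p)
value-< {𝟏} {_ ∷ w} (there (here refl) ∷ p)
  rewrite T-size (length w) | +-identityʳ (size 𝟎 (length w)) = +-monoʳ-< (size 𝟎 (length w)) (value-< p)

-- occ a (σᵏ(0))
place : Letter → ℕ → ℕ
place 𝟎 zero = 1
place 𝟏 zero = 0
place 𝟐 zero = 0
place 𝟎 (suc k) = place 𝟎 k + place 𝟏 k + place 𝟐 k
place 𝟏 (suc k) = place 𝟎 k
place 𝟐 (suc k) = place 𝟏 k

T-place : ∀ k → T k ≡ place 𝟎 k + place 𝟏 k + place 𝟐 k
T-place zero = refl
T-place (suc zero) = refl
T-place (suc (suc zero)) = refl
T-place (suc (suc (suc k))) = cong₂ _+_ (cong₂ _+_ (T-place (suc (suc k))) (T-place (suc k))) (T-place k)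

-- A digit 1 at place k stands for a block σ^k(0), as in the Dumont-Thomas factorisation of a prefix
-- of `tr`.
digitCount : Letter → List Digit → ℕ
digitCount a [] = 0
digitCount a (d ∷ w) = toℕ d * place a (length w) + digitCount a w

value-digitCount : ∀ w → value w ≡ digitCount 𝟎 w + digitCount 𝟏 w + digitCount 𝟐 w
value-digitCount [] = refl
value-digitCount (d ∷ w) = trans
  (cong₂ (λ t v → toℕ d * t + v) (T-place (length w)) (value-digitCount w))
  (rearrange (toℕ d) (place 𝟎 (length w)) (place 𝟏 (length w)) (place 𝟐 (length w)) _ _ _)
  where
  rearrange : ∀ d x y z x′ y′ z′ →
    d * (x + y + z) + (x′ + y′ + z′) ≡ d * x + x′ + (d * y + y′) + (d * z + z′)
  rearrange = solve-∀

length-∷ʳ : ∀ {A : Set} (w : List A) x → length (w ∷ʳ x) ≡ suc (length w)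
length-∷ʳ w x = trans (length-++ w) (+-comm (length w) 1)

-- Appending a digit raises every place by one, that is, applies σ to every block. Each letter then
-- gives one 0, and a new digit 1 adds another. In the next two lemmas, 1 arises only from 0, and 2
-- only from 1.
digitCount-∷ʳ-0 : ∀ w d → digitCount 𝟎 (w ∷ʳ d) ≡ value w + toℕ d
digitCount-∷ʳ-0 [] d = trans (+-identityʳ _) (*-identityʳ (toℕ d))
digitCount-∷ʳ-0 (x ∷ w) d rewrite length-∷ʳ w d | sym (T-place (length w)) =
  trans (cong (λ y → toℕ x * T (length w) + y) (digitCount-∷ʳ-0 w d)) (sym (+-assoc (toℕ x * T (length w)) _ _))

digitCount-∷ʳ-1 : ∀ w d → digitCount 𝟏 (w ∷ʳ d) ≡ digitCount 𝟎 w
digitCount-∷ʳ-1 [] d = trans (+-identityʳ _) (*-zeroʳ (toℕ d))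
digitCount-∷ʳ-1 (x ∷ w) d rewrite length-∷ʳ w d =
  cong (λ y → toℕ x * place 𝟎 (length w) + y) (digitCount-∷ʳ-1 w d)

digitCount-∷ʳ-2 : ∀ w d → digitCount 𝟐 (w ∷ʳ d) ≡ digitCount 𝟏 w
digitCount-∷ʳ-2 [] d = trans (+-identityʳ _) (*-zeroʳ (toℕ d))
digitCount-∷ʳ-2 (x ∷ w) d rewrite length-∷ʳ w d =
  cong (λ y → toℕ x * place 𝟏 (length w) + y) (digitCount-∷ʳ-2 w d)

-- Counts, rather than the value, are the inductive data: appending a digit acts on the three counts
-- by a linear rule, and their sum gives the value.
record Represents (w : List Digit) (n : ℕ) : Set where
  field
    path : Path 𝟎 w (tr n)
    counts : ∀ a → count a n ≡ digitCount a w

  value-≡ : value w ≡ n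
  value-≡ = begin
    value w                                               ≡⟨ value-digitCount w ⟩
    digitCount 𝟎 w + digitCount 𝟏 w + digitCount 𝟐 w      ≡⟨ cong₂ _+_ (cong₂ _+_ (counts 𝟎) (counts 𝟏)) (counts 𝟐) ⟨
    count 𝟎 n + count 𝟏 n + count 𝟐 n                     ≡⟨ count-sum n ⟨
    n                                                     ∎
    where open ≡-Reasoning

open Represents

represents-[] : Represents [] 0
represents-[] = record { path = [] ; counts = λ _ → refl }

represents-∷ʳ : ∀ {w n d a} → Represents w n → (d , a) ∈ children (tr n) →
  Represents (w ∷ʳ d) (blockStart n + toℕ d)
represents-∷ʳ {w} {n} {d} r s = record
  { path = subst (Path 𝟎 (w ∷ʳ d)) (sym (tr-child n s)) (path r ∷ʳᵖ s)
  ; counts = λ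
    { 𝟎 → trans (count-child-0 n d) (trans (cong (_+ toℕ d) (sym (value-≡ r))) (sym (digitCount-∷ʳ-0 w d)))
    ; 𝟏 → trans (count-child-1 n d) (trans (counts r 𝟎) (sym (digitCount-∷ʳ-1 w d)))
    ; 𝟐 → trans (count-child-2 n d) (trans (counts r 𝟏) (sym (digitCount-∷ʳ-2 w d)))
    }
  }

-- Paths give the greedy representation

≤ᵇ-true : ∀ {m n} → m ≤ n → (m ≤ᵇ n) ≡ true
≤ᵇ-true m≤n = Equivalence.to T-≡ (≤⇒≤ᵇ m≤n)

≤ᵇ-false : ∀ {m n} → n < m → (m ≤ᵇ n) ≡ false
≤ᵇ-false {m} {n} n<m with m ≤ᵇ n in eq
... | false = refl
... | true = ⊥-elim (<⇒≱ n<m (≤ᵇ⇒≤ m n (Equivalence.from T-≡ eq)))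

0-child-unique : ∀ {a b} → (𝟎 , b) ∈ children a → b ≡ 𝟎
0-child-unique {𝟎} (here refl) = refl
0-child-unique {𝟏} (here refl) = refl
0-child-unique {𝟐} (here refl) = refl
0-child-unique {𝟎} (there (here ()))
0-child-unique {𝟏} (there (here ()))

value-<T : ∀ {a b w e} → (𝟎 , b) ∈ children a → Path b w e → value w < T (length w)
value-<T {w = w} s p rewrite T-size (length w) | 0-child-unique s = value-< p

-- After a digit 0 the path goes on from the letter 0, so the remaining value is below the current
-- `T` and the greedy digit is 0 as well; a digit 1 contributes exactly that `T`.
greedy-value : ∀ {a w e} k → length w ≡ suc k → Path a w e → greedy k (value w) ≡ w
greedy-value zero refl (_∷_ {d = 𝟎} _ []) = refl
greedy-value zero refl (_∷_ {d = 𝟏} _ []) = refl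
greedy-value {w = _ ∷ w} (suc k) eq (_∷_ {d = 𝟎} s p)
  rewrite ≤ᵇ-false {T (suc k)} {value w} (subst (λ l → value w < T l) (suc-injective eq) (value-<T s p))
  = cong (𝟎 ∷_) (greedy-value k (suc-injective eq) p)
greedy-value {w = _ ∷ w} (suc k) eq (_∷_ {d = 𝟏} s p)
  rewrite suc-injective eq
  | *-identityˡ (T (suc k))
  | ≤ᵇ-true {T (suc k)} {T (suc k) + value w} (m≤m+n _ _)
  | m+n∸m≡n (T (suc k)) (value w) = cong (𝟏 ∷_) (greedy-value k (suc-injective eq) p)

pad-path : ∀ {w e} p → Path 𝟎 w e → Path 𝟎 (replicate p 𝟎 ++ w) e
pad-path zero q = q
pad-path (suc p) q = here refl ∷ pad-path p q

pad-value : ∀ p w → value (replicate p 𝟎 ++ w) ≡ value w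
pad-value zero w = refl
pad-value (suc p) w = pad-value p w

strip-pad : ∀ p w → dropWhileᵇ isZero (replicate p 𝟎 ++ 𝟏 ∷ w) ≡ 𝟏 ∷ w
strip-pad zero w = refl
strip-pad (suc p) w = strip-pad p w

trib-represents : ∀ {w n} → Represents (𝟏 ∷ w) n → trib n ≡ 𝟏 ∷ w
trib-represents {w} {n} r = begin
  dropWhileᵇ isZero (greedy n n)                         ≡⟨ cong (λ m → dropWhileᵇ isZero (greedy n m)) padded-value ⟨
  dropWhileᵇ isZero (greedy n (value padded))
    ≡⟨ cong (dropWhileᵇ isZero) (greedy-value n padded-length (pad-path p (path r))) ⟩
  dropWhileᵇ isZero padded                               ≡⟨ strip-pad p w ⟩
  𝟏 ∷ w                                                  ∎
  where
  open ≡-Reasoning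
  -- `greedy n` emits `suc n` digits, while the representation has `suc (length w)`.
  p = n ∸ length w
  padded = replicate p 𝟎 ++ 𝟏 ∷ w
  padded-value : value padded ≡ n
  padded-value = trans (pad-value p (𝟏 ∷ w)) (value-≡ r)
  w≤n : length w ≤ n
  w≤n = ≤-trans (<⇒≤ (n<T (length w))) (≤-trans (m≤m+n _ 0)
    (≤-trans (m≤m+n _ (value w)) (≤-reflexive (value-≡ r))))
  padded-length : length padded ≡ suc n
  padded-length = trans (length-++ (replicate p 𝟎)) (trans (cong (_+ suc (length w)) (length-replicate p))
    (trans (+-suc p _) (cong suc (m∸n+n≡m w≤n))))

-- Windows and the automaton on sets of windows

Window : Set
Window = ℤ × ℤ × Letter × Word

source : Window → Letter
source (_ , _ , a , _) = a

context : Window → Word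
context (_ , _ , _ , w) = w

_≟ʷ_ : DecidableEquality Window
_≟ʷ_ = ×.≡-dec ℤ._≟_ (×.≡-dec ℤ._≟_ (×.≡-dec Fin._≟_ (List.≡-dec Fin._≟_)))

-- `pred n` leaves out the last letter of the factor, which is the first letter of the context in
-- `window`.
excess : Letter → ℕ → ℕ → ℤ
excess a n i = + count a (i + pred n) ℤ.- (+ count a i ℤ.+ + count a n)

-- Summarises the factor of length n at i relative to the prefix of length n. It is anchored at the
-- last letter of the factor, so that the end of a child factor always lies to the right of the image
-- of the anchor and five letters of right context suffice.
window : ℕ → ℕ → Window
window n i = excess 𝟏 n i , excess 𝟐 n i , tr i , factor (i + pred n) 5

-- Distance from the start of the image of the anchor j = i + n - 1 to the anchor of the child. As
-- `blockStart m` is 2m minus `count 𝟐 m`, it is the excess of 2 plus c + d + 2(i + n - j) - 1, and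
-- the constant is 1.
offset : Digit → Digit → Window → ℤ
offset c d (_ , y , _) = y ℤ.+ + (1 + toℕ c + toℕ d)

-- The 1s and 2s of an image come from 0s and 1s. The three excesses sum to -1, so that of 0 is -(1
-- + x + y). The letters between the start of the image of the anchor and the new anchor are added.
childAt : Window → Letter → ℕ → Word → Window
childAt (x , y , _) a f v =
  + occ 𝟏 (take f v) ℤ.- (+ 1 ℤ.+ x ℤ.+ y) , x ℤ.+ + occ 𝟐 (take f v) , a , take 5 (drop f v)

child : Digit → Digit × Letter → Window → Window
child c (d , a) t = childAt t a ∣ offset c d t ∣ (σ* (context t))

-- The last term restores the letter that `excess` leaves out.
weight : Window → ℤ
weight (x , y , _ , w) = x ℤ.+ + 2 ℤ.* y ℤ.+ + toℕ (nth w 0)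

-- Windows are stored as numbers to make the exhaustive computation below fast; code is only
-- inverted by decode on small windows, which Faithful checks for those that occur.
opaque
  code : Window → ℕ
  code (x , y , a , w) = foldr (λ b n → toℕ b + 3 * n) (∣ x ℤ.+ + 4 ∣ + 8 * ∣ y ℤ.+ + 4 ∣) (a ∷ w)

  decode : ℕ → Window
  decode k = + (k / 729 % 8) ℤ.- + 4 , + (k / 5832) ℤ.- + 4 , k mod 3 , digits 5 (k / 3)
    where
    digits : ℕ → ℕ → Word
    digits zero k = []
    digits (suc n) k = k mod 3 ∷ digits n (k / 3)

-- Increasing lists represent sets canonically, so equal sets of windows give equal table entries.
insert : ℕ → List ℕ → List ℕ
insert k [] = k ∷ []
insert k (x ∷ xs) =
  if x <ᵇ k then x ∷ insert k xs else (if x ≡ᵇ k then x ∷ xs else k ∷ x ∷ xs)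

fromList : List ℕ → List ℕ
fromList = foldr insert []

nextCodes : Digit → Window → List ℕ
nextCodes c t = map (λ s → code (child c s t)) (children (source t))

next : Digit → List ℕ → List ℕ
next c X = fromList (concatMap (λ k → nextCodes c (decode k)) X)

-- First occurrences of the factors of length 5.
starts : List ℕ
starts = 0 ∷ 1 ∷ 2 ∷ 3 ∷ 4 ∷ 5 ∷ 6 ∷ 10 ∷ 11 ∷ 12 ∷ 23 ∷ []

initial : List ℕ → List ℕ
initial is = fromList (map (λ i → code (window 1 i)) is)

-- Row q lists the successors of state q under 0 and 1 and its output. Entries 0 are irrelevant: no
-- representation starts with 0, and a state entered by 11 is never followed by 1.
transitions : Vec (ℕ × ℕ × ℕ) 76
transitions =
  (0 , 1 , 1) ∷ (2 , 3 , 3) ∷ (4 , 5 , 3) ∷ (6 , 0 , 3) ∷ (7 , 8 , 3) ∷ (9 , 10 , 4) ∷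
  (11 , 5 , 4) ∷ (6 , 12 , 3) ∷ (13 , 14 , 3) ∷ (15 , 5 , 4) ∷ (16 , 0 , 3) ∷ (17 , 18 , 4) ∷
  (6 , 3 , 3) ∷ (4 , 19 , 3) ∷ (20 , 0 , 3) ∷ (21 , 22 , 3) ∷ (11 , 19 , 4) ∷ (20 , 23 , 3) ∷
  (16 , 14 , 3) ∷ (9 , 24 , 4) ∷ (25 , 26 , 4) ∷ (27 , 18 , 4) ∷ (28 , 14 , 4) ∷ (27 , 10 , 4) ∷
  (29 , 0 , 3) ∷ (30 , 18 , 5) ∷ (28 , 31 , 4) ∷ (32 , 5 , 5) ∷ (15 , 19 , 4) ∷ (33 , 34 , 4) ∷
  (35 , 23 , 4) ∷ (36 , 0 , 3) ∷ (37 , 38 , 4) ∷ (17 , 39 , 4) ∷ (40 , 41 , 4) ∷ (42 , 26 , 4) ∷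
  (25 , 43 , 4) ∷ (44 , 45 , 4) ∷ (46 , 14 , 4) ∷ (29 , 47 , 3) ∷ (48 , 49 , 5) ∷ (50 , 0 , 4) ∷
  (51 , 18 , 5) ∷ (28 , 52 , 4) ∷ (53 , 26 , 5) ∷ (46 , 31 , 4) ∷ (32 , 19 , 5) ∷ (35 , 0 , 4) ∷
  (21 , 54 , 3) ∷ (30 , 10 , 5) ∷ (33 , 55 , 4) ∷ (56 , 23 , 5) ∷ (57 , 0 , 3) ∷ (58 , 38 , 5) ∷
  (59 , 60 , 4) ∷ (40 , 61 , 4) ∷ (62 , 45 , 4) ∷ (63 , 64 , 4) ∷ (65 , 45 , 4) ∷ (48 , 66 , 4) ∷
  (67 , 0 , 4) ∷ (68 , 0 , 4) ∷ (62 , 45 , 5) ∷ (30 , 39 , 5) ∷ (69 , 70 , 4) ∷ (71 , 26 , 5) ∷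
  (30 , 24 , 5) ∷ (25 , 72 , 4) ∷ (33 , 64 , 4) ∷ (48 , 66 , 5) ∷ (57 , 0 , 4) ∷ (62 , 38 , 5) ∷
  (59 , 73 , 4) ∷ (74 , 0 , 4) ∷ (25 , 75 , 4) ∷ (59 , 70 , 4) ∷ []

δ : Fin 76 → Digit → Fin 76
δ q 𝟎 = proj₁ (lookup transitions q) mod 76
δ q 𝟏 = proj₁ (proj₂ (lookup transitions q)) mod 76

out : Fin 76 → ℕ
out q = proj₂ (proj₂ (lookup transitions q))

M : DFAO (Fin 76) ℕ
M = record { q₀ = 𝟎 ; δ = δ ; out = out }

Entry : Set
Entry = Letter × List ℕ

_≟ᵉ_ : DecidableEquality Entry
_≟ᵉ_ = ×.≡-dec Fin._≟_ (List.≡-dec ℕ._≟_)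

open DecMembership _≟ᵉ_ using (_∈?_)

Table : Set
Table = Vec (List Entry) 76

-- Nothing is proved about the search: closed? validates its result.
explore : ℕ → List (Fin 76 × Entry) → Table → Table
explore zero todo seen = seen
explore (suc n) [] seen = seen
explore (suc n) ((q , l , X) ∷ todo) seen with does ((l , X) ∈? lookup seen q)
... | true = explore n todo seen
... | false = explore n (map (λ (c , l′) → δ q c , l′ , next c X) (children l) ++ todo)
  (updateAt seen q ((l , X) ∷_))

-- What makes `child` correct: the absolute value loses no sign, the image of the context reaches
-- five letters past the offset, and the code of the result can be inverted.
Faithful : Digit → Digit × Letter → Window → Set
Faithful c (d , a) t =
    + ∣ offset c d t ∣ ≡ offset c d t
  × ∣ offset c d t ∣ + 5 ≤ length (σ* (context t))
  × decode (code (child c (d , a) t)) ≡ child c (d , a) t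

faithful? : ∀ c s t → Dec (Faithful c s t)
faithful? c (d , a) t = (_ ℤ.≟ _) ×-dec (_ ≤? _) ×-dec (_ ≟ʷ _)

weights : List ℕ → List ℤ
weights X = deduplicate ℤ._≟_ (map (λ k → weight (decode k)) X)

FaithfulCode : ℕ → Set
FaithfulCode k = ∀ c → All (λ s → Faithful c s (decode k)) (children (source (decode k)))

-- Faithfulness concerns single windows, so it is checked once per element of `codes`; the sublist
-- condition transfers it to every set in the table.
Consistent : List ℕ → Table → Fin 76 → Entry → Set
Consistent codes tb q (l , X) = X ⊆ codes
  × length (weights X) ≡ out q
  × (out q ≡ 3 ⊎ out q ≡ 4 ⊎ out q ≡ 5)
  × All (λ (c , l′) → (l′ , next c X) ∈ lookup tb (δ q c)) (children l)

Closed : List ℕ → Table → Set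
Closed codes tb = All FaithfulCode codes
  × (𝟏 , initial starts) ∈ lookup tb 𝟏
  × (∀ q → All (Consistent codes tb q) (lookup tb q))

closed? : ∀ codes tb → Dec (Closed codes tb)
closed? codes tb =
  all? (λ k → Fin.all? λ c → all? (λ s → faithful? c s (decode k)) _) codes
  ×-dec (_ ∈? _)
  ×-dec Fin.all? (λ q → all? (λ (l , X) →
    (X ⊆? codes)
    ×-dec (_ ℕ.≟ _)
    ×-dec ((_ ℕ.≟ _) ⊎-dec (_ ℕ.≟ _) ⊎-dec (_ ℕ.≟ _))
    ×-dec all? (λ (c , l′) → _ ∈? _) (children l)) (lookup tb q))

codesOf : Table → List ℕ
codesOf tb = fromList (concatMap (concatMap proj₂) (Vec.toList tb))

reachable : Table
-- Each of the 422 pairs queues at most two children, so at most 845 items are processed.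
reachable = explore 900 ((𝟏 , 𝟏 , initial starts) ∷ []) (Vec.replicate 76 [])

opaque
  unfolding code decode
  -- Only the existence of some closed table is exported; opacity keeps its large normal form out of
  -- later proofs.
  closedTable : ∃ λ tb → Closed (codesOf tb) tb
  closedTable = certify reachable _
    where
    certify : ∀ tb → True (closed? (codesOf tb) tb) → ∃ λ tb → Closed (codesOf tb) tb
    certify tb ok = tb , toWitness ok

-- Membership in the computed sets

insert⁺ : ∀ {y} k xs → y ≡ k ⊎ y ∈ xs → y ∈ insert k xs
insert⁺ k [] (inj₁ refl) = here refl
insert⁺ k (x ∷ xs) p with x <ᵇ k | x ≡ᵇ k in eq | p
... | true  | _     | inj₁ refl = there (insert⁺ k xs (inj₁ refl))
... | true  | _     | inj₂ (here refl) = here refl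
... | true  | _     | inj₂ (there q) = there (insert⁺ k xs (inj₂ q))
... | false | true  | inj₁ refl = here (sym (≡ᵇ⇒≡ x k (Equivalence.from T-≡ eq)))
... | false | true  | inj₂ q = q
... | false | false | inj₁ refl = here refl
... | false | false | inj₂ q = there q

insert⁻ : ∀ {y} k xs → y ∈ insert k xs → y ≡ k ⊎ y ∈ xs
insert⁻ k [] (here refl) = inj₁ refl
insert⁻ k (x ∷ xs) p with x <ᵇ k | x ≡ᵇ k | p
... | true  | _     | here refl = inj₂ (here refl)
... | true  | _     | there q = Sum.map₂ there (insert⁻ k xs q)
... | false | true  | q = inj₂ q
... | false | false | here refl = inj₁ refl
... | false | false | there q = inj₂ q

fromList⁺ : ∀ {y} xs → y ∈ xs → y ∈ fromList xs
fromList⁺ (x ∷ xs) (here eq) = insert⁺ x (fromList xs) (inj₁ eq)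
fromList⁺ (x ∷ xs) (there p) = insert⁺ x (fromList xs) (inj₂ (fromList⁺ xs p))

fromList⁻ : ∀ {y} xs → y ∈ fromList xs → y ∈ xs
fromList⁻ (x ∷ xs) p with insert⁻ x (fromList xs) p
... | inj₁ eq = here eq
... | inj₂ q = there (fromList⁻ xs q)

next⁺ : ∀ {c k s} X → k ∈ X → s ∈ children (source (decode k)) → code (child c s (decode k)) ∈ next c X
next⁺ {c} X k∈ s∈ = fromList⁺ (concatMap (λ k → nextCodes c (decode k)) X)
  (∈-concatMap⁺ (λ k → nextCodes c (decode k)) (Any.map (λ { refl → ∈-map⁺ (λ s → code (child c s (decode _))) s∈ }) k∈))

next⁻ : ∀ {c y} X → y ∈ next c X →
  ∃₂ λ k s → k ∈ X × s ∈ children (source (decode k)) × y ≡ code (child c s (decode k))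
next⁻ {c} X y∈ with find (∈-concatMap⁻ (λ k → nextCodes c (decode k)) {xs = X} (fromList⁻ _ y∈))
... | k , k∈ , p with ∈-map⁻ (λ s → code (child c s (decode k))) p
... | s , s∈ , eq = k , s , k∈ , s∈ , eq

-- The window of a child

factor-child : ∀ j f → f + 5 ≤ length (σ* (factor j 5)) →
  take f (σ* (factor j 5)) ≡ factor (blockStart j) f ×
  take 5 (drop f (σ* (factor j 5))) ≡ factor (blockStart j + f) 5
factor-child j f f+5≤ =
  trans (cong (take f) eq) (take-factor (blockStart j) f (≤-trans (m≤m+n f 5) f+5≤)) ,
  trans (cong (λ w → take 5 (drop f w)) eq)
    (trans (cong (take 5) (drop-factor (blockStart j) f L))
      (take-factor (blockStart j + f) 5 (m+n≤o⇒m≤o∸n 5 (≤-trans (≤-reflexive (+-comm 5 f)) f+5≤))))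
  where
  L = length (σ* (factor j 5))
  eq = σ*-factor j 5

count-0-ℤ : ∀ n → + count 𝟎 n ≡ + n ℤ.- + count 𝟏 n ℤ.- + count 𝟐 n
count-0-ℤ n = trans (cancel (+ count 𝟎 n) (+ count 𝟏 n) (+ count 𝟐 n))
  (cong (λ m → + m ℤ.- + count 𝟏 n ℤ.- + count 𝟐 n) (sym (count-sum n)))
  where
  cancel : ∀ x y z → x ≡ (x ℤ.+ y ℤ.+ z) ℤ.- y ℤ.- z
  cancel = ℤ-solve-∀

module WindowChild (m i : ℕ) (c d : Digit) (a : Letter)
  (faithful : Faithful c (d , a) (window (suc m) i)) where

  open ≡-Reasoning

  n = suc m
  j = i + m
  f = ∣ offset c d (window n i) ∣
  n′ = blockStart n + toℕ c
  i′ = blockStart i + toℕ d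

  offset-ℕ : f + (count 𝟐 i + count 𝟐 n) ≡ count 𝟐 j + (1 + toℕ c + toℕ d)
  offset-ℕ = ℤ.+-injective (begin
    + f ℤ.+ + (count 𝟐 i + count 𝟐 n)
      ≡⟨ cong (λ x → x ℤ.+ + (count 𝟐 i + count 𝟐 n)) (proj₁ faithful) ⟩
    excess 𝟐 n i ℤ.+ + (1 + toℕ c + toℕ d) ℤ.+ + (count 𝟐 i + count 𝟐 n)
      ≡⟨ cancel (+ count 𝟐 j) (+ (count 𝟐 i + count 𝟐 n)) (+ (1 + toℕ c + toℕ d)) ⟩
    + count 𝟐 j ℤ.+ + (1 + toℕ c + toℕ d) ∎)
    where
    cancel : ∀ x y z → (x ℤ.- y ℤ.+ z) ℤ.+ y ≡ x ℤ.+ z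
    cancel = ℤ-solve-∀

  suc-pred-n′ : suc (pred n′) ≡ n′
  suc-pred-n′ = suc-pred n′ {{>-nonZero (≤-trans (<-trans (s≤s z≤n) (n<blockStart m)) (m≤m+n _ _))}}

  -- The equation that `offset` encodes. Adding the counts of 2 lets `blockStart-count` replace each
  -- block start by a double, and the extra successor turns `pred n′` into `n′`.
  anchor : i′ + pred n′ ≡ blockStart j + f
  anchor = +-cancelʳ-≡ (suc (count 𝟐 i + count 𝟐 n + count 𝟐 j)) _ _ (begin
    i′ + pred n′ + suc (count 𝟐 i + count 𝟐 n + count 𝟐 j)
      ≡⟨ rearrange₁ (blockStart i) (toℕ d) (pred n′) (count 𝟐 i) (count 𝟐 n) (count 𝟐 j) ⟩
    (blockStart i + count 𝟐 i) + toℕ d + (suc (pred n′) + count 𝟐 n) + count 𝟐 j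
      ≡⟨ cong₂ (λ x y → x + toℕ d + (y + count 𝟐 n) + count 𝟐 j) (blockStart-count i) suc-pred-n′ ⟩
    (i + i) + toℕ d + (n′ + count 𝟐 n) + count 𝟐 j
      ≡⟨ rearrange₂ (i + i) (toℕ d) (blockStart n) (toℕ c) (count 𝟐 n) (count 𝟐 j) ⟩
    (i + i) + toℕ d + toℕ c + (blockStart n + count 𝟐 n) + count 𝟐 j
      ≡⟨ cong (λ x → (i + i) + toℕ d + toℕ c + x + count 𝟐 j) (blockStart-count n) ⟩
    (i + i) + toℕ d + toℕ c + (n + n) + count 𝟐 j
      ≡⟨ rearrange₃ i (toℕ d) (toℕ c) m (count 𝟐 j) ⟩
    (j + j) + (count 𝟐 j + (1 + toℕ c + toℕ d)) + 1
      ≡⟨ cong₂ (λ x y → x + y + 1) (blockStart-count j) offset-ℕ ⟨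
    (blockStart j + count 𝟐 j) + (f + (count 𝟐 i + count 𝟐 n)) + 1
      ≡⟨ rearrange₄ (blockStart j) (count 𝟐 j) f (count 𝟐 i) (count 𝟐 n) ⟩
    blockStart j + f + suc (count 𝟐 i + count 𝟐 n + count 𝟐 j) ∎)
    where
    rearrange₁ : ∀ b d p x y z → b + d + p + suc (x + y + z) ≡ (b + x) + d + (suc p + y) + z
    rearrange₁ = solve-∀
    rearrange₂ : ∀ k d b c y z → k + d + (b + c + y) + z ≡ k + d + c + (b + y) + z
    rearrange₂ = solve-∀
    rearrange₃ : ∀ i d c m z →
      i + i + d + c + (suc m + suc m) + z ≡ (i + m + (i + m)) + (z + (1 + c + d)) + 1
    rearrange₃ = solve-∀
    rearrange₄ : ∀ b z f x y → (b + z) + (f + (x + y)) + 1 ≡ b + f + suc (x + y + z)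
    rearrange₄ = solve-∀

  u : Word
  u = take f (σ* (factor j 5))

  count-anchor : ∀ a → count a (i′ + pred n′) ≡ occ a (σ* (factor 0 j)) + occ a u
  count-anchor a = begin
    count a (i′ + pred n′)                                ≡⟨ cong (count a) anchor ⟩
    count a (blockStart j + f)                            ≡⟨ count-+ a (blockStart j) f ⟩
    count a (blockStart j) + occ a (factor (blockStart j) f)
      ≡⟨ cong₂ (λ x w → x + occ a w) (count-blockStart a j) (sym (proj₁ (factor-child j f (proj₁ (proj₂ faithful))))) ⟩
    occ a (σ* (factor 0 j)) + occ a u                     ∎

  excess-1 : excess 𝟏 n′ i′ ≡ + occ 𝟏 u ℤ.- (+ 1 ℤ.+ excess 𝟏 n i ℤ.+ excess 𝟐 n i)
  excess-1 = begin
    excess 𝟏 n′ i′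
      ≡⟨ cong₂ (λ x y → + x ℤ.- + y) (trans (count-anchor 𝟏) (cong (_+ occ 𝟏 u) (occ-σ*-1 (factor 0 j))))
           (cong₂ _+_ (count-child-1 i d) (count-child-1 n c)) ⟩
    + count 𝟎 j ℤ.+ + occ 𝟏 u ℤ.- (+ count 𝟎 i ℤ.+ + count 𝟎 n)
      -- The counts of 0 are eliminated in favour of the lengths and the two counts that a window
      -- keeps.
      ≡⟨ cong₂ (λ x y → x ℤ.+ + occ 𝟏 u ℤ.- y) (count-0-ℤ j) (cong₂ ℤ._+_ (count-0-ℤ i) (count-0-ℤ n)) ⟩
    _ ≡⟨ rearrange (+ i) (+ m) (+ occ 𝟏 u) (+ count 𝟏 j) (+ count 𝟐 j) (+ count 𝟏 i) (+ count 𝟐 i) (+ count 𝟏 n) (+ count 𝟐 n) ⟩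
    + occ 𝟏 u ℤ.- (+ 1 ℤ.+ excess 𝟏 n i ℤ.+ excess 𝟐 n i) ∎
    where
    rearrange : ∀ i m o xj yj xi yi xn yn →
      (i ℤ.+ m ℤ.- xj ℤ.- yj) ℤ.+ o ℤ.- ((i ℤ.- xi ℤ.- yi) ℤ.+ ((+ 1 ℤ.+ m) ℤ.- xn ℤ.- yn))
        ≡ o ℤ.- (+ 1 ℤ.+ (xj ℤ.- (xi ℤ.+ xn)) ℤ.+ (yj ℤ.- (yi ℤ.+ yn)))
    rearrange = ℤ-solve-∀

  excess-2 : excess 𝟐 n′ i′ ≡ excess 𝟏 n i ℤ.+ + occ 𝟐 u
  excess-2 = begin
    excess 𝟐 n′ i′
      ≡⟨ cong₂ (λ x y → + x ℤ.- + y) (trans (count-anchor 𝟐) (cong (_+ occ 𝟐 u) (occ-σ*-2 (factor 0 j))))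
           (cong₂ _+_ (count-child-2 i d) (count-child-2 n c)) ⟩
    + count 𝟏 j ℤ.+ + occ 𝟐 u ℤ.- (+ count 𝟏 i ℤ.+ + count 𝟏 n)
      ≡⟨ rearrange (+ count 𝟏 j) (+ occ 𝟐 u) (+ count 𝟏 i ℤ.+ + count 𝟏 n) ⟩
    excess 𝟏 n i ℤ.+ + occ 𝟐 u ∎
    where
    rearrange : ∀ x o y → x ℤ.+ o ℤ.- y ≡ (x ℤ.- y) ℤ.+ o
    rearrange = ℤ-solve-∀

  window-child : (d , a) ∈ children (tr i) → window n′ i′ ≡ child c (d , a) (window n i)
  window-child s = cong₂ _,_ excess-1 (cong₂ _,_ excess-2 (cong₂ _,_ (tr-child i s)
    (trans (cong (λ t → factor t 5) anchor) (sym (proj₂ (factor-child j f (proj₁ (proj₂ faithful))))))))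

open WindowChild using (window-child)

-- The set of all windows of a length

record Enumerates (X : List ℕ) (n : ℕ) : Set where
  field
    complete : ∀ i → ∃ λ k → k ∈ X × decode k ≡ window n i
    sound : ∀ {k} → k ∈ X → ∃ λ i → decode k ≡ window n i

open Enumerates

-- Completeness holds because every position has a parent, soundness because every child of a
-- position is again a position.
enumerates-next : ∀ {X n} c → 1 ≤ n → (∀ {k} → k ∈ X → FaithfulCode k) →
  Enumerates X n → Enumerates (next c X) (blockStart n + toℕ c)
enumerates-next {X} {suc m} c _ faithful e = record { complete = complete′ ; sound = sound′ }
  where
  n′ = blockStart (suc m) + toℕ c
  step : ∀ {k i} s → k ∈ X → decode k ≡ window (suc m) i → s ∈ children (tr i) →
    decode (code (child c s (decode k))) ≡ window n′ (blockStart i + toℕ (proj₁ s))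
  step {k} {i} (d , a) k∈ eq s∈ = trans (proj₂ (proj₂ F)) (trans (cong (child c (d , a)) eq)
    (sym (window-child m i c d a (subst (Faithful c (d , a)) eq F) s∈)))
    where
    F : Faithful c (d , a) (decode k)
    F = All.lookup (faithful k∈ c) (subst (λ t → (d , a) ∈ children (source t)) (sym eq) s∈)
  complete′ : ∀ i → ∃ λ k → k ∈ next c X × decode k ≡ window n′ i
  complete′ p with parent p
  ... | mkParent i d s∈ refl with complete e i
  ... | k , k∈ , eq = _ , next⁺ X k∈ (subst (λ t → _ ∈ children (source t)) (sym eq) s∈) , step {i = i} _ k∈ eq s∈
  sound′ : ∀ {k} → k ∈ next c X → ∃ λ i → decode k ≡ window n′ i
  sound′ y∈ with next⁻ X y∈
  ... | k , s , k∈ , s∈ , refl with sound e k∈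
  ... | i , eq = blockStart i + toℕ (proj₁ s) , step {i = i} s k∈ eq (subst (λ t → s ∈ children (source t)) eq s∈)

-- Factors of length 5 and the windows of length 1

ChildOccurs : ℕ → Digit × Letter → Set
ChildOccurs s (d , a) = toℕ d + 5 ≤ length (σ* (factor s 5))
  × Any (λ s′ → take 5 (drop (toℕ d) (σ* (factor s 5))) ≡ factor s′ 5) starts

starts-closed : All (λ s → All (ChildOccurs s) (children (tr s))) starts
starts-closed = toWitness {a? = all? (λ s → all? (λ (d , a) →
  (_ ≤? _) ×-dec Any.any? (λ s′ → List.≡-dec Fin._≟_ _ _) starts) _) starts} tt

Start : ℕ → Set
Start p = ∃ λ s → s ∈ starts × factor p 5 ≡ factor s 5

child-start : ∀ i d a s → factor i 5 ≡ factor s 5 → ChildOccurs s (d , a) → Start (blockStart i + toℕ d)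
child-start i d a s same (long , occurs) =
  let s′ , s′∈ , eq = find occurs in s′ , s′∈ , (begin
    factor (blockStart i + toℕ d) 5
      ≡⟨ proj₂ (factor-child i (toℕ d) (subst (λ w → toℕ d + 5 ≤ length (σ* w)) (sym same) long)) ⟨
    take 5 (drop (toℕ d) (σ* (factor i 5)))  ≡⟨ cong (λ w → take 5 (drop (toℕ d) (σ* w))) same ⟩
    take 5 (drop (toℕ d) (σ* (factor s 5)))  ≡⟨ eq ⟩
    factor s′ 5                              ∎)
  where open ≡-Reasoning

-- The factor of length 5 at a child is read off the image of the one at its parent. Since `starts`
-- contains 0 and is closed under this passage, induction along parents covers all positions.
start : ∀ p → Start p
start = <-rec Start step
  where
  lift : ∀ {p} (P : Parent p) → Start (Parent.n P) → Start p
  lift {p} (mkParent i d d∈ position) (s , s∈ , same) =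
    subst Start (sym position) (child-start i d (tr p) s same (All.lookup (All.lookup starts-closed s∈)
      (subst (λ x → (d , tr p) ∈ children x) (cong (λ w → nth w 0) same) d∈)))
  smaller : ∀ {p} (P : Parent (suc p)) → Parent.n P < suc p
  smaller (mkParent zero _ _ _) = s≤s z≤n
  smaller (mkParent (suc i) d _ position) = subst (suc i <_) (sym position) (n<child (suc i) d (s≤s z≤n))
  step : ∀ p → (∀ {i} → i < p → Start i) → Start p
  step zero _ = 0 , here refl , refl
  step (suc p) rec = lift (parent (suc p)) (rec (smaller (parent (suc p))))

-- A factor of length 1 without its last letter is empty, and the prefix of length 1 is 0, so both
-- excesses vanish.
window-1 : ∀ i → window 1 i ≡ (+ 0 , + 0 , tr i , factor i 5)
window-1 i rewrite +-identityʳ i = cong₂ (λ x y → x , y , tr i , factor i 5) (cancel (+ count 𝟏 i)) (cancel (+ count 𝟐 i))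
  where
  cancel : ∀ x → x ℤ.- (x ℤ.+ + 0) ≡ + 0
  cancel = ℤ-solve-∀

opaque
  unfolding code decode
  decode-initial : All (λ i → decode (code (window 1 i)) ≡ window 1 i) starts
  decode-initial = toWitness {a? = all? (λ i → _ ≟ʷ _) starts} tt

enumerates-initial : Enumerates (initial starts) 1
enumerates-initial = record { complete = complete′ ; sound = sound′ }
  where
  codes = map (λ i → code (window 1 i)) starts
  complete′ : ∀ i → ∃ λ k → k ∈ initial starts × decode k ≡ window 1 i
  complete′ i with start i
  ... | s , s∈ , eq = code (window 1 s) , fromList⁺ codes (∈-map⁺ (λ i → code (window 1 i)) s∈) , (begin
    decode (code (window 1 s))       ≡⟨ All.lookup decode-initial s∈ ⟩
    window 1 s                       ≡⟨ window-1 s ⟩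
    (+ 0 , + 0 , tr s , factor s 5)  ≡⟨ cong (λ w → + 0 , + 0 , nth w 0 , w) eq ⟨
    (+ 0 , + 0 , tr i , factor i 5)  ≡⟨ window-1 i ⟨
    window 1 i                       ∎)
    where open ≡-Reasoning
  sound′ : ∀ {k} → k ∈ initial starts → ∃ λ i → decode k ≡ window 1 i
  sound′ k∈ with ∈-map⁻ (λ i → code (window 1 i)) (fromList⁻ codes k∈)
  ... | i , i∈ , refl = i , All.lookup decode-initial i∈

-- Weights of windows and additive complexity

factorWeight : ℕ → ℕ → ℕ
factorWeight i n = occ 𝟏 (factor i n) + 2 * occ 𝟐 (factor i n)

letter-weight : ∀ a → toℕ a ≡ occ 𝟏 [ a ] + 2 * occ 𝟐 [ a ]
letter-weight 𝟎 = refl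
letter-weight 𝟏 = refl
letter-weight 𝟐 = refl

occ-excess : ∀ a m i →
  + occ a (factor i (suc m)) ≡ excess a (suc m) i ℤ.+ + occ a [ tr (i + m) ] ℤ.+ + count a (suc m)
occ-excess a m i = begin
  + occ a (factor i (suc m))
    ≡⟨ isolate (+ count a i) (+ occ a (factor i (suc m))) ⟩
  + count a i ℤ.+ + occ a (factor i (suc m)) ℤ.- + count a i
    ≡⟨ cong (λ x → + x ℤ.- + count a i) (begin
      count a i + occ a (factor i (suc m))     ≡⟨ count-+ a i (suc m) ⟨
      count a (i + suc m)                      ≡⟨ cong (count a) (trans (+-suc i m) (+-comm 1 (i + m))) ⟩
      count a (i + m + 1)                      ≡⟨ count-+ a (i + m) 1 ⟩
      count a (i + m) + occ a [ tr (i + m) ]   ∎) ⟩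
  + count a (i + m) ℤ.+ + occ a [ tr (i + m) ] ℤ.- + count a i
    ≡⟨ rearrange (+ count a (i + m)) (+ occ a [ tr (i + m) ]) (+ count a i) (+ count a (suc m)) ⟩
  excess a (suc m) i ℤ.+ + occ a [ tr (i + m) ] ℤ.+ + count a (suc m) ∎
  where
  open ≡-Reasoning
  isolate : ∀ x y → y ≡ x ℤ.+ y ℤ.- x
  isolate = ℤ-solve-∀
  rearrange : ∀ x o y z → x ℤ.+ o ℤ.- y ≡ (x ℤ.- (y ℤ.+ z)) ℤ.+ o ℤ.+ z
  rearrange = ℤ-solve-∀

-- For fixed `n` the shift is constant, so equality of weights characterises additive equivalence.
weight-window : ∀ {n} i → 1 ≤ n → weight (window n i) ≡ + factorWeight i n ℤ.- + factorWeight 0 n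
weight-window {suc m} i _ = sym (begin
  + factorWeight i n ℤ.- + factorWeight 0 n
    ≡⟨ cong₂ ℤ._-_ (+-weight (occ 𝟏 (factor i n)) (occ 𝟐 (factor i n))) (+-weight (count 𝟏 n) (count 𝟐 n)) ⟩
  (+ occ 𝟏 (factor i n) ℤ.+ + 2 ℤ.* + occ 𝟐 (factor i n)) ℤ.- (+ count 𝟏 n ℤ.+ + 2 ℤ.* + count 𝟐 n)
    ≡⟨ cong₂ (λ x y → (x ℤ.+ + 2 ℤ.* y) ℤ.- (+ count 𝟏 n ℤ.+ + 2 ℤ.* + count 𝟐 n)) (occ-excess 𝟏 m i) (occ-excess 𝟐 m i) ⟩
  _ ≡⟨ rearrange (excess 𝟏 n i) (excess 𝟐 n i) (+ occ 𝟏 [ tr j ]) (+ occ 𝟐 [ tr j ]) (+ count 𝟏 n) (+ count 𝟐 n) ⟩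
  excess 𝟏 n i ℤ.+ + 2 ℤ.* excess 𝟐 n i ℤ.+ (+ occ 𝟏 [ tr j ] ℤ.+ + 2 ℤ.* + occ 𝟐 [ tr j ])
    ≡⟨ cong (λ x → excess 𝟏 n i ℤ.+ + 2 ℤ.* excess 𝟐 n i ℤ.+ x)
         (trans (sym (+-weight (occ 𝟏 [ tr j ]) (occ 𝟐 [ tr j ]))) (cong +_ (sym (letter-weight (tr j))))) ⟩
  weight (window n i) ∎)
  where
  open ≡-Reasoning
  n = suc m
  j = i + m
  +-weight : ∀ x y → + (x + 2 * y) ≡ + x ℤ.+ + 2 ℤ.* + y
  +-weight x y = cong (λ z → + x ℤ.+ z) (ℤ.pos-* 2 y)
  rearrange : ∀ e₁ e₂ o₁ o₂ c₁ c₂ →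
    ((e₁ ℤ.+ o₁ ℤ.+ c₁) ℤ.+ + 2 ℤ.* (e₂ ℤ.+ o₂ ℤ.+ c₂)) ℤ.- (c₁ ℤ.+ + 2 ℤ.* c₂)
      ≡ e₁ ℤ.+ + 2 ℤ.* e₂ ℤ.+ (o₁ ℤ.+ + 2 ℤ.* o₂)
  rearrange = ℤ-solve-∀

weight⇒AddEquiv : ∀ {n} i i′ → 1 ≤ n →
  weight (window n i) ≡ weight (window n i′) → AddEquiv (factor i n) (factor i′ n)
weight⇒AddEquiv {n} i i′ 1≤n eq = trans (factor-length i n) (sym (factor-length i′ n)) , ℤ.+-injective (begin
  + factorWeight i n                                   ≡⟨ restore i ⟩
  weight (window n i) ℤ.+ + factorWeight 0 n           ≡⟨ cong (ℤ._+ + factorWeight 0 n) eq ⟩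
  weight (window n i′) ℤ.+ + factorWeight 0 n          ≡⟨ restore i′ ⟨
  + factorWeight i′ n                                  ∎)
  where
  open ≡-Reasoning
  cancel : ∀ x y → x ≡ (x ℤ.- y) ℤ.+ y
  cancel = ℤ-solve-∀
  restore : ∀ i → + factorWeight i n ≡ weight (window n i) ℤ.+ + factorWeight 0 n
  restore i = trans (cancel (+ factorWeight i n) (+ factorWeight 0 n))
    (cong (ℤ._+ + factorWeight 0 n) (sym (weight-window i 1≤n)))

AddEquiv⇒weight : ∀ {n} i i′ → 1 ≤ n →
  AddEquiv (factor i n) (factor i′ n) → weight (window n i) ≡ weight (window n i′)
AddEquiv⇒weight {n} i i′ 1≤n (_ , eq) = trans (weight-window i 1≤n)
  (trans (cong (λ x → + x ℤ.- + factorWeight 0 n) eq) (sym (weight-window i′ 1≤n)))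

preimages : ∀ {A B : Set} (f : A → B) {ys} → All (λ y → ∃ λ x → f x ≡ y) ys → ∃ λ xs → map f xs ≡ ys
preimages f [] = [] , refl
preimages f ((x , eq) ∷ ps) with preimages f ps
... | xs , eqs = x ∷ xs , cong₂ _∷_ eq eqs

-- One position is picked for each distinct weight. Distinct weights make the representatives
-- inequivalent, and every factor shares its weight with one of them.
enumerates⇒complexity : ∀ {X n} → 1 ≤ n → Enumerates X n → AddComplexity n (length (weights X))
enumerates⇒complexity {X} {n} 1≤n e = map (λ i → factor i n) is ,
    trans (List.length-map _ is) (trans (sym (List.length-map w is)) (cong length is-weights)) ,
    (λ u u∈ → let i , _ , eq = ∈-map⁻ _ u∈ in i , sym eq) ,
    AllPairs.map⁺ (AllPairs.map (λ {i} {i′} i≢i′ equiv → i≢i′ (AddEquiv⇒weight i i′ 1≤n equiv))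
      (AllPairs.map⁻ (subst Unique (sym is-weights) (deduplicate-! _)))) ,
    λ i → let i′ , i′∈ , eq = ∈-map⁻ w (subst (w i ∈_) (sym is-weights) (occurs i)) in
      lose (∈-map⁺ (λ i → factor i n) i′∈) (weight⇒AddEquiv i i′ 1≤n eq)
  where
  w : ℕ → ℤ
  w i = weight (window n i)
  realised : ∀ {v} → v ∈ weights X → ∃ λ i → w i ≡ v
  realised v∈ with ∈-map⁻ (λ k → weight (decode k)) (∈-deduplicate⁻ ℤ._≟_ _ v∈)
  ... | k , k∈ , refl with sound e k∈
  ... | i , eq = i , cong weight (sym eq)
  occurs : ∀ i → w i ∈ weights X
  occurs i with complete e i
  ... | k , k∈ , eq = ∈-deduplicate⁺ ℤ._≟_
    (subst (_∈ map (λ k → weight (decode k)) X) (cong weight eq) (∈-map⁺ (λ k → weight (decode k)) k∈))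
  is = proj₁ (preimages w {weights X} (All.tabulate realised))
  is-weights : map w is ≡ weights X
  is-weights = proj₂ (preimages w (All.tabulate realised))

-- The case of the empty representation: the initial state has output 1.
complexity-0 : AddComplexity 0 1
complexity-0 = [] ∷ [] , refl , (λ { _ (here refl) → 0 , refl }) , ([] ∷ []) , λ _ → here (refl , refl)

-- Running the automaton along representations

table : Table
table = proj₁ closedTable

-- Several sets of windows may share a state; the invariant asks that the one of `n` be listed at
-- `q`, with the letter `tr n` that decides which children exist.
record Reaches (n : ℕ) (q : Fin 76) : Set where
  field
    positive : 1 ≤ n
    {windows} : List ℕ
    tabulated : (tr n , windows) ∈ lookup table q
    enumerates : Enumerates windows n

  consistent : Consistent (codesOf table) table q (tr n , windows)
  consistent = All.lookup (proj₂ (proj₂ (proj₂ closedTable)) q) tabulated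

  complexity : AddComplexity n (out q)
  complexity = subst (AddComplexity n) (proj₁ (proj₂ consistent)) (enumerates⇒complexity positive enumerates)

  out-345 : out q ≡ 3 ⊎ out q ≡ 4 ⊎ out q ≡ 5
  out-345 = proj₁ (proj₂ (proj₂ consistent))

  reaches-child : ∀ {c a} → (c , a) ∈ children (tr n) → Reaches (blockStart n + toℕ c) (δ q c)
  reaches-child {c} {a} c∈ = record
    { positive = <⇒≤ (≤-<-trans positive (n<child n c positive))
    ; tabulated = subst (λ b → (b , next c windows) ∈ lookup table (δ q c)) (sym (tr-child n c∈))
        (All.lookup (proj₂ (proj₂ (proj₂ consistent))) c∈)
    ; enumerates = enumerates-next c positive
        (λ k∈ → All.lookup (proj₁ (proj₂ closedTable)) (Sublist.lookup (proj₁ consistent) k∈)) enumerates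
    }

open Reaches

reaches-1 : Reaches 1 𝟏
reaches-1 = record
  { positive = s≤s z≤n
  ; tabulated = proj₁ (proj₂ (proj₂ closedTable))
  ; enumerates = enumerates-initial
  }

-- Removing the last digit leads to the parent. The descent ends at 1, the only positive child of 0,
-- where the windows are known.
reaches-trib : ∀ n → 1 ≤ n → Reaches n (run M (trib n))
reaches-trib n 1≤n = let w , r , reach = numeral n 1≤n in
  subst (λ v → Reaches n (run M v)) (sym (trib-represents r)) reach
  where
  Numeral : ℕ → Set
  Numeral n = ∃ λ w → Represents (𝟏 ∷ w) n × Reaches n (run M (𝟏 ∷ w))
  extend : ∀ {n c a} → Numeral n → (c , a) ∈ children (tr n) → Numeral (blockStart n + toℕ c)
  extend {n} {c} (w , r , reach) c∈ = w ∷ʳ c , represents-∷ʳ r c∈ ,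
    subst (Reaches _) (sym (List.foldl-∷ʳ δ 𝟎 c (𝟏 ∷ w))) (reaches-child reach c∈)
  child-of-0 : ∀ {c a} → 1 ≤ toℕ c → (c , a) ∈ children (tr 0) → Numeral (toℕ c)
  child-of-0 () (here refl)
  child-of-0 _ (there (here refl)) = [] , represents-∷ʳ represents-[] (there (here refl)) , reaches-1
  step : ∀ p → (∀ {n} → n < p → 1 ≤ n → Numeral n) → 1 ≤ p → Numeral p
  step p rec 1≤p with parent p
  ... | mkParent zero c c∈ refl = child-of-0 1≤p c∈
  ... | mkParent (suc n) c c∈ refl = extend (rec (n<child (suc n) c (s≤s z≤n)) (s≤s z≤n)) c∈
  numeral : ∀ n → 1 ≤ n → Numeral n
  numeral = <-rec _ step

-- Values taken infinitely often

reaches-path : ∀ {n q w a} → Reaches n q → Path (tr n) w a → ∃ λ n′ → n ≤ n′ × Reaches n′ (foldl δ q w)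
reaches-path reach [] = _ , ≤-refl , reach
reaches-path {n} {a = a} reach (_∷_ {d = c} {w = w} c∈ p)
  with reaches-path (reaches-child reach c∈) (subst (λ b → Path b w a) (sym (tr-child n c∈)) p)
... | n′ , n≤n′ , reach′ = n′ , ≤-trans (<⇒≤ (n<child n c (positive reach))) n≤n′ , reach′

-- Every letter has a child with digit 0, and this child is the letter 0. The leading 0 thus makes
-- the word readable whatever `tr n` is.
reaches-0-path : ∀ {n q w a} → Reaches n q → Path 𝟎 w a → ∃ λ n′ → n < n′ × Reaches n′ (foldl δ q (𝟎 ∷ w))
reaches-0-path {n} {w = w} {a} reach p with reaches-path (reaches-child reach 0∈) (subst (λ b → Path b w a) (sym (tr-child n 0∈)) p)
  where 0∈ = 0-child (tr n)
... | n′ , n≤n′ , reach′ = n′ , <-≤-trans (n<child n 𝟎 (positive reach)) n≤n′ , reach′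

-- The word `𝟎 ∷ w` can be read again and again with strictly growing `n`, and after the first
-- reading the state no longer changes from one reading to the next.
recurrent : ∀ {w a} → Path 𝟎 w a → let q = foldl δ 𝟏 (𝟎 ∷ w) in
  foldl δ q (𝟎 ∷ w) ≡ q → ∀ m → ∃ λ n → m < n × AddComplexity n (out q)
recurrent {w} p loop m = let n , m<n , reach = unbounded m in n , m<n , complexity reach
  where
  unbounded : ∀ m → ∃ λ n → m < n × Reaches n (foldl δ 𝟏 (𝟎 ∷ w))
  unbounded zero = let n , 1<n , reach = reaches-0-path reaches-1 p in n , <-trans (s≤s z≤n) 1<n , reach
  unbounded (suc m) = let n , m<n , reach = unbounded m
                          n′ , n<n′ , reach′ = reaches-0-path reach p
                      in n′ , ≤-<-trans m<n n<n′ , subst (Reaches n′) loop reach′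

theorem4p2 : ((n : ℕ) → 1 ≤ n → Σ ℕ λ k → AddComplexity n k × (k ≡ 3 ⊎ k ≡ 4 ⊎ k ≡ 5))
    × ((m : ℕ) → Σ ℕ λ n → (m < n) × AddComplexity n 3)
    × ((m : ℕ) → Σ ℕ λ n → (m < n) × AddComplexity n 4)
    × ((m : ℕ) → Σ ℕ λ n → (m < n) × AddComplexity n 5)
    × (Σ (DFAO (Fin 76) ℕ) λ M → (n : ℕ) → AddComplexity n (eval M (trib n)))
theorem4p2 =
    (λ n 1≤n → _ , complexity (reaches-trib n 1≤n) , out-345 (reaches-trib n 1≤n))
  -- From state 1 the words 001, 01 and 001100 lead to the states 8, 5 and 25, with outputs 3, 4 and
  -- 5. The same words then run around the cycles (8, 13, 4), (5, 9) and (25, 30, 35, 26, 31, 36).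
  , recurrent {𝟎 ∷ 𝟏 ∷ []} (0-child 𝟎 ∷ 0→1 ∷ []) refl
  , recurrent {𝟏 ∷ []} (0→1 ∷ []) refl
  , recurrent {𝟎 ∷ 𝟏 ∷ 𝟏 ∷ 𝟎 ∷ 𝟎 ∷ []} (0-child 𝟎 ∷ 0→1 ∷ 1→2 ∷ 0-child 𝟐 ∷ 0-child 𝟎 ∷ []) refl
  , M , λ { zero → complexity-0 ; (suc n) → complexity (reaches-trib (suc n) (s≤s z≤n)) }
  where
  0→1 : (𝟏 , 𝟏) ∈ children 𝟎
  0→1 = there (here refl)
  1→2 : (𝟏 , 𝟐) ∈ children 𝟏
  1→2 = there (here refl)
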